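{- Let $H$ be a finite simple graph on $n$ vertices, and let $KH_1,KH_2,\ldots,KH_s$ be the replication cliques of $H$ (in some chosen order), of sizes $y_1,\ldots,y_s\ge 1$. For $i=1,\ldots,s$ let $n_i$ denote the number of non-edges between a (any) vertex of $KH_i$ and the vertices of $KH_1\cup\cdots\cup KH_{i-1}$. Then $$\rho(H) \leq n+ \sum_{i=1}^s n_i.$$ Moreover, among all orderings of the replication cliques, the right-hand side is smallest when the ordering satisfies $y_1 \le y_2 \le \cdots \le y_s$.
   Context: All graphs are finite and simple. A coloring means a proper vertex coloring; an induced subgraph is rainbow if all its vertices have pairwise different colors. For a graph $H$, $\rho(H)$ is the least number $m$ such that there exists a graph $G$ on $m$ vertices such that every proper vertex coloring of $G$ contains a rainbow induced subgraph isomorphic to $H$. On $V(H)$ define $x\sim y$ iff $x=y$, or $xy$ is an edge of $H$ and $x,y$ have exactly the same neighbors in $H-\{x,y\}$; this is an equivalence relation whose classes are cliques, called the replication cliques of $H$. Since vertices in one replication clique have the same neighbors outside it, $n_i$ does not depend on the choice of vertex in $KH_i$. A non-edge is a pair of distinct non-adjacent vertices. -}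

module Defs where

open import Algebra.Properties.CommutativeMonoid.Sum using (sum)
open import Data.Fin using (Fin; _≤_; _<?_; _≟_)
open import Data.Fin.Subset using (Subset; _∈_; ∣_∣; ⋃)
open import Data.Fin.Subset.Properties using (_∈?_)
open import Data.List using (length; filter; map; allFin)
open import Data.Nat as ℕ using (ℕ; _+_)
open import Data.Nat.Properties using (+-0-commutativeMonoid)
open import Data.Product using (Σ; ∃; _×_; proj₁)
open import Data.Sum using (_⊎_)
open import Function using (_∘_; _on_; _↔_; _⇔_; Inverse; Injective)
open import Relation.Binary using (Rel; Symmetric; Irreflexive; Decidable)
open import Relation.Binary.PropositionalEquality using (_≡_; _≢_)
open import Relation.Nullary.Decidable using (¬?; _×-dec_)
open import Level using (0ℓ)

record Graph (V : Set) : Set₁ where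
  field
    Adj     : Rel V 0ℓ
    sym     : Symmetric Adj
    irrefl  : Irreflexive _≡_ Adj
    _adj?_  : Decidable Adj

-- A finite graph on n vertices is a Graph (Fin n); Graph is kept polymorphic
-- in the vertex type so that induced subgraphs are again graphs.

induced : ∀ {m} → Graph (Fin m) → (S : Subset m) → Graph (Σ (Fin m) (_∈ S))
induced G S = record
  { Adj    = Adj on proj₁
  ; sym    = sym
  ; irrefl = λ { _≡_.refl → irrefl _≡_.refl }
  ; _adj?_ = λ u v → proj₁ u adj? proj₁ v
  }
  where open Graph G

infix 4 _≅_

record _≅_ {V W : Set} (G : Graph V) (H : Graph W) : Set where
  field
    bijection : V ↔ W
  open Inverse bijection using (to)
  field
    preserves : ∀ x y → Graph.Adj G x y ⇔ Graph.Adj H (to x) (to y)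

-- Colours are natural numbers; the number of colours is not restricted.

Proper : ∀ {V} → Graph V → (V → ℕ) → Set
Proper G c = ∀ u v → Graph.Adj G u v → c u ≢ c v

Rainbow : ∀ {m} → (Fin m → ℕ) → Subset m → Set
Rainbow c S = ∀ u v → u ∈ S → v ∈ S → u ≢ v → c u ≢ c v

ForcesRainbow : ∀ {m n} → Graph (Fin m) → Graph (Fin n) → Set
ForcesRainbow {m} G H =
  (c : Fin m → ℕ) → Proper G c →
  ∃ λ (S : Subset m) → H ≅ induced G S × Rainbow c S

ForcedOn : ∀ {n} → Graph (Fin n) → ℕ → Set₁
ForcedOn H m = Σ (Graph (Fin m)) λ G → ForcesRainbow G H

-- Is-ρ H r expresses ρ(H) = r.

Is-ρ : ∀ {n} → Graph (Fin n) → ℕ → Set₁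
Is-ρ H r = ForcedOn H r × (∀ m → ForcedOn H m → r ℕ.≤ m)

module _ {n : ℕ} (H : Graph (Fin n)) where
  open Graph H

  infix 4 _~_

  _~_ : Rel (Fin n) 0ℓ
  x ~ y = x ≡ y ⊎ (Adj x y × (∀ z → z ≢ x → z ≢ y → Adj x z ⇔ Adj y z))

  IsReplicationClique : Subset n → Set
  IsReplicationClique K = ∃ λ x → ∀ y → y ∈ K ⇔ x ~ y

  record CliqueOrdering : Set where
    field
      s          : ℕ
      KH         : Fin s → Subset n
      isClique   : ∀ i → IsReplicationClique (KH i)
      distinct   : Injective _≡_ _≡_ KH
      exhaustive : ∀ K → IsReplicationClique K → ∃ λ i → KH i ≡ K

    earlier : Fin s → Subset n
    earlier i = ⋃ (map KH (filter (_<? i) (allFin s)))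

  Sorted : CliqueOrdering → Set
  Sorted O = ∀ i j → i ≤ j → ∣ KH i ∣ ℕ.≤ ∣ KH j ∣
    where open CliqueOrdering O

  -- A choice of one vertex in each clique. The count of non-edges from it to the
  -- earlier cliques is the same for every choice.

  Representatives : CliqueOrdering → Set
  Representatives O = ∀ i → Σ (Fin n) (_∈ KH i)
    where open CliqueOrdering O

  nonEdges : Fin n → Subset n → ℕ
  nonEdges v U =
    length (filter (λ u → (u ∈? U) ×-dec ¬? (v ≟ u) ×-dec ¬? (v adj? u)) (allFin n))

  bound : (O : CliqueOrdering) → Representatives O → ℕ
  bound O v = n + sum +-0-commutativeMonoid (λ i → nonEdges (proj₁ (v i)) (earlier i))
    where open CliqueOrdering O

{-# OPTIONS --safe #-}

-- Blow up each replication clique KH_i of H to a clique of size y_i + n_i. In any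
-- proper colouring of the resulting graph, embed H greedily, clique by clique: when
-- a vertex of KH_i is placed, only the colours of its clique-mates and of the n_i
-- earlier vertices not adjacent to it are to be avoided, the others being avoided
-- by properness, and the blown-up clique has a further colour. For the second part,
-- every non-adjacent pair of cliques contributes the size of its earlier member to
-- Σ n_i, which is at least the smaller of the two sizes, with equality throughout
-- for a sorted ordering. That ρ(H) exists constructively holds because forcing is
-- decidable: m colours suffice for graphs on m vertices.

module Submission where

open import Defs
import Algebra.Properties.Semiring.Sum as SemiringSum
open import Data.Bool using (true; false; if_then_else_)
open import Data.Fin using (Fin; zero; suc; _≟_; toℕ; _↑ˡ_; _↑ʳ_; splitAt;
  combine; quotient; remQuot; finToFun; funToFin)
  renaming (_<_ to _<ᶠ_; _<?_ to _<ᶠ?_)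
open import Data.Fin.Permutation using (Permutation; permutation)
open import Data.Fin.Properties using
  ( any?; all?; toℕ-injective; toℕ<n; suc-injective; <-cmp; <⇒≢; pigeonhole
  ; splitAt-↑ˡ; splitAt-↑ʳ; ↑ˡ-injective; ↑ʳ-injective
  ; remQuot-combine; combine-injectiveʳ; combine-monoˡ-<; finToFun-funToFin )
open import Data.Fin.Subset using (Subset; _∈_; ∣_∣; ⋃; inside; outside)
open import Data.Fin.Subset.Properties using (_∈?_; anySubset?; ⊆-antisym; x∈p∪q⁺; x∈p∪q⁻; ∉⊥)
open import Data.List using (List; []; _∷_; _++_; length; lookup; map; filter; allFin; tabulate)
import Data.List.Membership.DecPropositional as DecMembership
open import Data.List.Membership.Propositional using () renaming (_∈_ to _∈ˡ_; _∉_ to _∉ˡ_)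
open import Data.List.Membership.Propositional.Properties using
  (∈-map⁺; ∈-map⁻; ∈-++⁻; ∈-++⁺ˡ; ∈-++⁺ʳ; ∈-filter⁺; ∈-filter⁻; ∈-allFin; ∈-lookup)
open import Data.List.Properties using (length-++; length-map; length-tabulate)
import Data.List.Relation.Unary.All as All
open import Data.List.Relation.Unary.AllPairs using (_∷_)
open import Data.List.Relation.Unary.Any using (index; here; there)
open import Data.List.Relation.Unary.Any.Properties using (lookup-index)
open import Data.List.Relation.Unary.Unique.Propositional using (Unique)
import Data.List.Relation.Unary.Unique.Propositional.Properties as Unique
open import Data.Nat as ℕ using (ℕ; zero; suc; _+_; _*_; _≤_; _<_; z≤n; s≤s)
open import Data.Nat.Induction using (<-rec)
open import Data.Nat.Properties as ℕₚ using (≤-reflexive; anyUpTo?; m<1+n⇒m<n∨m≡n; +-*-semiring)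
open import Data.Product using (Σ; ∃; _×_; _,_; proj₁; proj₂; uncurry)
open import Data.Sum using (_⊎_; inj₁; inj₂; [_,_]′; swap)
open import Data.Vec as Vec using ([]; _∷_)
open import Data.Vec.Properties using (lookup∘tabulate; []=⇒lookup; lookup⇒[]=)
open import Data.Vec.Properties.WithK using ([]=-irrelevant)
open import Function using (_∘_; id; _⇔_; mk⇔; mk↔ₛ′; Equivalence; Injection; Inverse)
open import Function.Properties.Inverse using (↔⇒↣)
open import Level using (Level)
open import Relation.Binary using (tri<; tri≈; tri>)
open import Relation.Binary.PropositionalEquality using
  (_≡_; _≢_; _≗_; refl; sym; trans; cong; cong₂; subst; subst₂; module ≡-Reasoning)
open import Relation.Nullary using (¬_; Dec; yes; no; does; contradiction)
open import Relation.Nullary.Decidable using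
  (map′; ¬?; _×-dec_; _→-dec_; _⊎-dec_; does-⇔; dec-true; dec-false; decidable-stable)
open import Relation.Unary using (Pred; Decidable)

open DecMembership ℕ._≟_ using () renaming (_∈?_ to _∈ℕ?_)
open Equivalence using (to; from)
open SemiringSum +-*-semiring using
  (*-distribˡ-sum; ∑-comm; ∑-distrib-+; sum-permute; sum-cong-≗) renaming (sum to total)

private variable
  a p : Level
  A B : Set a
  n m k : ℕ

-- Decidable subsets of, and functions between, finite sets.

infix 3 _⇔-dec_

_⇔-dec_ : Dec A → Dec B → Dec (A ⇔ B)
a? ⇔-dec b? =
  map′ (uncurry mk⇔) (λ e → to e , from e) ((a? →-dec b?) ×-dec (b? →-dec a?))

comprehension : {P : Pred (Fin n) p} → Decidable P → Subset n
comprehension P? = Vec.tabulate (does ∘ P?)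

∈-comprehension : {P : Pred (Fin n) p} (P? : Decidable P) → ∀ x → x ∈ comprehension P? ⇔ P x
∈-comprehension P? x = mk⇔ fwd bwd
  where
  fwd : x ∈ comprehension P? → _
  fwd x∈ with P? x | trans (sym (lookup∘tabulate (does ∘ P?) x)) ([]=⇒lookup x∈)
  ... | yes px | _ = px
  ... | no  _  | ()
  bwd : _ → x ∈ comprehension P?
  bwd px = lookup⇒[]= x _ (trans (lookup∘tabulate (does ∘ P?) x) (dec-true (P? x) px))

module _ {P : Pred (Fin m → Fin k) p} (P? : Decidable P)
         (P-resp : ∀ {f g} → f ≗ g → P f → P g) where

  -- Functions are searched through their codes in a finite type. Decoding the code of `f` returns
  -- `f` only pointwise, hence the hypothesis `P-resp`.
  anyFunction? : Dec (∃ P)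
  anyFunction? = map′
    (λ (i , q) → finToFun i , q)
    (λ (f , q) → funToFin f , P-resp (sym ∘ finToFun-funToFin f) q)
    (any? (P? ∘ finToFun))

  allFunctions? : Dec (∀ f → P f)
  allFunctions? = map′
    (λ q f → P-resp (finToFun-funToFin f) (q (funToFin f)))
    (λ q i → q (finToFun i))
    (all? (P? ∘ finToFun))

-- Rainbow induced copies as embeddings.

-- The second clause speaks of colours, so it yields injectivity of `f` and rainbowness of its image
-- at once. Functions, unlike isomorphisms onto a subset, are easily enumerated.
RainbowEmbedding : Graph (Fin m) → Graph (Fin n) → (Fin m → ℕ) → (Fin n → Fin m) → Set
RainbowEmbedding G H c f =
  (∀ x y → Graph.Adj H x y ⇔ Graph.Adj G (f x) (f y)) × (∀ x y → c (f x) ≡ c (f y) → x ≡ y)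

module _ (G : Graph (Fin m)) (H : Graph (Fin n)) where
  private
    module G = Graph G
    module H = Graph H

  subset⇒embedding : ∀ {c} → (∃ λ S → H ≅ induced G S × Rainbow c S) → ∃ (RainbowEmbedding G H c)
  subset⇒embedding {c} (S , iso , rainbow) = proj₁ ∘ φ , preserves , injective
    where
    open _≅_ iso
    φ = Inverse.to bijection
    injective : ∀ x y → c (proj₁ (φ x)) ≡ c (proj₁ (φ y)) → x ≡ y
    injective x y eq with φ x in ex | φ y in ey
    ... | u , u∈ | v , v∈ with u ≟ v
    ... | no u≢v = contradiction eq (rainbow u v u∈ v∈ u≢v)
    -- Membership proofs are unique, so equal vertices are equal elements of the induced subgraph.
    ... | yes refl = Injection.injective (↔⇒↣ bijection)
      (trans ex (trans (cong (u ,_) ([]=-irrelevant u∈ v∈)) (sym ey)))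

  embedding⇒subset : ∀ {c} → ∃ (RainbowEmbedding G H c) → ∃ λ S → H ≅ induced G S × Rainbow c S
  embedding⇒subset {c} (f , preserves , injective) = S , iso , rainbow
    where
    image? : Decidable (λ y → ∃ λ x → f x ≡ y)
    image? y = any? (λ x → f x ≟ y)
    S : Subset _
    S = comprehension image?
    ∈S : ∀ y → y ∈ S ⇔ (∃ λ x → f x ≡ y)
    ∈S = ∈-comprehension image?
    φ : Fin n → Σ (Fin m) (_∈ S)
    φ x = f x , from (∈S (f x)) (x , refl)
    ψ : Σ (Fin m) (_∈ S) → Fin n
    ψ (y , y∈) = proj₁ (to (∈S y) y∈)
    φψ : ∀ z → φ (ψ z) ≡ z
    φψ (y , y∈) with to (∈S y) y∈
    ... | x , refl = cong (f x ,_) ([]=-irrelevant _ _)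
    ψφ : ∀ x → ψ (φ x) ≡ x
    ψφ x = injective _ _ (cong (c ∘ proj₁) (φψ (φ x)))
    iso : H ≅ induced G S
    iso = record { bijection = mk↔ₛ′ φ ψ φψ ψφ ; preserves = preserves }
    rainbow : Rainbow c S
    rainbow u v u∈ v∈ u≢v eq with to (∈S u) u∈ | to (∈S v) v∈
    ... | x , refl | y , refl = u≢v (cong f (injective x y eq))

  rainbowEmbedding? : ∀ c → Dec (∃ (RainbowEmbedding G H c))
  rainbowEmbedding? c = anyFunction?
    (λ f → (all? λ x → all? λ y → (x H.adj? y) ⇔-dec (f x G.adj? f y))
           ×-dec (all? λ x → all? λ y → (c (f x) ℕ.≟ c (f y)) →-dec (x ≟ y)))
    λ {f} {g} f≗g (preserves , injective) →
      (λ x y → subst₂ (λ a b → H.Adj x y ⇔ G.Adj a b) (f≗g x) (f≗g y) (preserves x y)) ,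
      (λ x y eq → injective x y (subst₂ (λ a b → c a ≡ c b) (sym (f≗g x)) (sym (f≗g y)) eq))

  proper? : ∀ c → Dec (Proper G c)
  proper? c = all? λ u → all? λ v → (u G.adj? v) →-dec ¬? (c u ℕ.≟ c v)

-- Every colouring of m vertices has the same colour classes as one that colours
-- each vertex by a chosen member of its class.

classMember : (Fin m → ℕ) → ℕ → Fin m → Fin m
classMember c colour default with any? (λ y → c y ℕ.≟ colour)
... | yes (y , _) = y
... | no  _       = default

classMember-colour : ∀ (c : Fin m → ℕ) x d → c (classMember c (c x) d) ≡ c x
classMember-colour c x d with any? (λ y → c y ℕ.≟ c x)
... | yes (_ , eq) = eq
... | no ∄y        = contradiction (x , refl) ∄y

-- The default is returned only for a colour that no vertex has.
classMember-irrelevant : ∀ (c : Fin m → ℕ) x d d′ → classMember c (c x) d ≡ classMember c (c x) d′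
classMember-irrelevant c x d d′ with any? (λ y → c y ℕ.≟ c x)
... | yes _ = refl
... | no ∄y = contradiction (x , refl) ∄y

module _ (c : Fin m → ℕ) where

  normalise : Fin m → Fin m
  normalise x = classMember c (c x) x

  normalise-reflects : ∀ x y → normalise x ≡ normalise y → c x ≡ c y
  normalise-reflects x y eq =
    trans (sym (classMember-colour c x x)) (trans (cong c eq) (classMember-colour c y y))

  normalise-preserves : ∀ x y → c x ≡ c y → normalise x ≡ normalise y
  normalise-preserves x y eq =
    trans (classMember-irrelevant c x x y) (cong (λ k → classMember c k y) eq)

-- Properness and rainbowness depend only on the colour classes. It therefore suffices to test the
-- finitely many colourings with values in `Fin m`, and an arbitrary colouring is replaced by its
-- normalised form.
forcesRainbow? : (G : Graph (Fin m)) (H : Graph (Fin n)) → Dec (ForcesRainbow G H)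
forcesRainbow? {m} {n} G H = map′ fwd bwd (allFunctions? forcedBy? forcedBy-resp)
  where
  ForcedBy : (Fin m → Fin m) → Set
  ForcedBy c = Proper G (toℕ ∘ c) → ∃ (RainbowEmbedding G H (toℕ ∘ c))

  forcedBy? : Decidable ForcedBy
  forcedBy? c = proper? G H (toℕ ∘ c) →-dec rainbowEmbedding? G H (toℕ ∘ c)

  forcedBy-resp : ∀ {c d} → c ≗ d → ForcedBy c → ForcedBy d
  forcedBy-resp {c} {d} c≗d forced proper =
    let f , preserves , injective = forced λ u v uv eq →
          proper u v uv (trans (cong toℕ (sym (c≗d u))) (trans eq (cong toℕ (c≗d v))))
    in f , preserves , λ x y eq →
         injective x y (trans (cong toℕ (c≗d (f x))) (trans eq (cong toℕ (sym (c≗d (f y))))))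

  fwd : (∀ c → ForcedBy c) → ForcesRainbow G H
  fwd forced c proper =
    let f , preserves , injective = forced (normalise c) λ u v uv eq →
          proper u v uv (normalise-reflects c u v (toℕ-injective eq))
    in embedding⇒subset G H (f , preserves , λ x y eq →
         injective x y (cong toℕ (normalise-preserves c (f x) (f y) eq)))

  bwd : ForcesRainbow G H → ∀ c → ForcedBy c
  bwd forced c proper = subset⇒embedding G H (forced (toℕ ∘ c) proper)

-- Graphs coded by subsets, and the existence of ρ(H).

module _ (M : Subset (m * m)) where

  private
    Joined : Fin m → Fin m → Set
    Joined x y = combine x y ∈ M

  -- Distinctness and both orders are built in, so every subset codes a graph, and a search over
  -- subsets meets every graph up to equivalent adjacency.
  decode : Graph (Fin m)
  decode = record
    { Adj    = λ x y → x ≢ y × (Joined x y ⊎ Joined y x)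
    ; sym    = λ (x≢y , j) → x≢y ∘ sym , swap j
    ; irrefl = λ x≡y (x≢y , _) → x≢y x≡y
    ; _adj?_ = λ x y → ¬? (x ≟ y) ×-dec (combine x y ∈? M ⊎-dec combine y x ∈? M)
    }

module _ (G : Graph (Fin m)) where
  open Graph G using (Adj; _adj?_; irrefl) renaming (sym to adj-sym)

  private
    adjacent? : Decidable (λ (k : Fin (m * m)) → uncurry Adj (remQuot {m} m k))
    adjacent? k = uncurry _adj?_ (remQuot {m} m k)

  encode : Subset (m * m)
  encode = comprehension adjacent?

  ∈-encode : ∀ x y → combine x y ∈ encode ⇔ Adj x y
  ∈-encode x y = subst (λ q → combine x y ∈ encode ⇔ uncurry Adj q) (remQuot-combine x y)
    (∈-comprehension adjacent? (combine x y))

  decode-encode : ∀ x y → Graph.Adj (decode encode) x y ⇔ Adj x y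
  decode-encode x y = mk⇔
    (λ (_ , j) → [ to (∈-encode x y) , adj-sym ∘ to (∈-encode y x) ]′ j)
    (λ xy → (λ x≡y → irrefl x≡y xy) , inj₁ (from (∈-encode x y) xy))

forcesRainbow-resp : (G G′ : Graph (Fin m)) (H : Graph (Fin n)) →
  (∀ x y → Graph.Adj G x y ⇔ Graph.Adj G′ x y) → ForcesRainbow G H → ForcesRainbow G′ H
forcesRainbow-resp G G′ H G⇔G′ forced c proper =
  let f , preserves , injective =
        subset⇒embedding G H (forced c λ u v → proper u v ∘ to (G⇔G′ u v))
  in embedding⇒subset G′ H
       (f , (λ x y → mk⇔ (to (G⇔G′ (f x) (f y)) ∘ to (preserves x y))
                         (from (preserves x y) ∘ from (G⇔G′ (f x) (f y)))) , injective)

forcedOn? : (H : Graph (Fin n)) → ∀ m → Dec (ForcedOn H m)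
forcedOn? H m = map′
  (λ (M , forced) → decode M , forced)
  (λ (G , forced) → encode G ,
    forcesRainbow-resp G (decode (encode G)) H
      (λ x y → mk⇔ (from (decode-encode G x y)) (to (decode-encode G x y))) forced)
  (anySubset? λ M → forcesRainbow? (decode M) H)

-- Strong induction on a witness: either a smaller witness exists or this one is minimal.
least : {P : Pred ℕ p} → Decidable P → ∃ P → ∃ λ k → P k × (∀ l → P l → k ≤ l)
least {P = P} P? = uncurry (<-rec (λ k → P k → ∃ λ k → P k × (∀ l → P l → k ≤ l)) step)
  where
  step : ∀ k → (∀ {j} → j < k → P j → _) → P k → ∃ λ k → P k × (∀ l → P l → k ≤ l)
  step k smaller Pk with anyUpTo? P? k
  ... | yes (j , j<k , Pj) = smaller j<k Pj
  ... | no ∄j = k , Pk , λ l Pl → ℕₚ.≮⇒≥ λ l<k → ∄j (l , l<k , Pl)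

-- Replication classes and blow-ups.

module Replication (H : Graph (Fin n)) where
  open Graph H renaming (sym to adj-sym)

  infix 4 _≈_ _≈?_

  _≈_ : Fin n → Fin n → Set
  _≈_ = _~_ H

  _≈?_ : ∀ x y → Dec (x ≈ y)
  x ≈? y = (x ≟ y) ⊎-dec ((x adj? y) ×-dec
    (all? λ z → ¬? (z ≟ x) →-dec (¬? (z ≟ y) →-dec ((x adj? z) ⇔-dec (y adj? z)))))

  ≈-refl : ∀ {x} → x ≈ x
  ≈-refl = inj₁ refl

  ≈-sym : ∀ {x y} → x ≈ y → y ≈ x
  ≈-sym (inj₁ refl) = inj₁ refl
  ≈-sym (inj₂ (xy , twins)) =
    inj₂ (adj-sym xy , λ z z≢y z≢x → mk⇔ (from (twins z z≢x z≢y)) (to (twins z z≢x z≢y)))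

  -- The twin condition is silent about the twins themselves: irreflexivity excludes `y ≡ x`, and
  -- `¬ a ≈ y` excludes `y ≡ a`.
  adj-transport : ∀ {x a y} → x ≈ a → ¬ a ≈ y → Adj x y → Adj a y
  adj-transport (inj₁ refl) _ xy = xy
  adj-transport (inj₂ (_ , twins)) a≉y xy =
    to (twins _ (λ y≡x → irrefl (sym y≡x) xy) (λ y≡a → a≉y (inj₁ (sym y≡a)))) xy

  ≈-trans : ∀ {x y z} → x ≈ y → y ≈ z → x ≈ z
  ≈-trans (inj₁ refl) y≈z = y≈z
  ≈-trans (inj₂ xy) (inj₁ refl) = inj₂ xy
  ≈-trans {x} {y} {z} (inj₂ (xy , x-y)) (inj₂ (yz , y-z)) with x ≟ z
  ... | yes x≡z = inj₁ x≡z
  ... | no x≢z =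
    inj₂ (from (x-y z (x≢z ∘ sym) (λ z≡y → irrefl (sym z≡y) yz)) yz , x-z)
    where
    x-z : ∀ w → w ≢ x → w ≢ z → Adj x w ⇔ Adj z w
    x-z w w≢x w≢z with w ≟ y
    -- Neither twin condition covers the middle vertex `y`, but it is adjacent to both ends.
    ... | yes refl = mk⇔ (λ _ → adj-sym yz) (λ _ → xy)
    ... | no w≢y   = mk⇔ (to (y-z w w≢y w≢z) ∘ to (x-y w w≢x w≢y))
                         (from (x-y w w≢x w≢y) ∘ from (y-z w w≢y w≢z))

  ≈-adj : ∀ {x y} → x ≈ y → x ≢ y → Adj x y
  ≈-adj (inj₁ x≡y) x≢y = contradiction x≡y x≢y
  ≈-adj (inj₂ (xy , _)) _ = xy

  -- The endpoints move one at a time: `x` to `a` with `y` fixed, then `y` to `b`.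
  adj-transport₂ : ∀ {x y a b} → x ≈ a → y ≈ b → ¬ x ≈ y → Adj x y → Adj a b
  adj-transport₂ x≈a y≈b x≉y xy =
    adj-sym (adj-transport y≈b (λ b≈a → x≉y (≈-trans x≈a (≈-sym (≈-trans y≈b b≈a))))
      (adj-sym (adj-transport x≈a (λ a≈y → x≉y (≈-trans x≈a a≈y)) xy)))

  -- G arises from H by replacing each replication clique by the clique of all
  -- vertices whose label lies in it.

  blowup : (Fin m → Fin n) → Graph (Fin m)
  blowup label = record
    { Adj    = λ x y → x ≢ y × (label x ≈ label y ⊎ Adj (label x) (label y))
    ; sym    = λ (x≢y , j) → x≢y ∘ sym , [ inj₁ ∘ ≈-sym , inj₂ ∘ adj-sym ]′ j
    ; irrefl = λ x≡y (x≢y , _) → x≢y x≡y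
    ; _adj?_ = λ x y → ¬? (x ≟ y) ×-dec ((label x ≈? label y) ⊎-dec (label x adj? label y))
    }

-- Greedy rainbow embedding into a blow-up.

unique-lookup-< : {xs : List A} → Unique xs → ∀ {i j} → i <ᶠ j → lookup xs i ≢ lookup xs j
unique-lookup-< (x∉ ∷ _)   {zero}  {suc j} _         = All.lookup x∉ (∈-lookup j)
unique-lookup-< (_  ∷ xs!) {suc i} {suc j} (s≤s i<j) = unique-lookup-< xs! i<j

-- If every candidate had a forbidden colour, sending it to the position of that colour in `ks`
-- would, by pigeonhole, give two candidates one colour.
available : (c : Fin m → ℕ) (xs : List (Fin m)) (ks : List ℕ) → Unique xs →
  (∀ {x y} → x ∈ˡ xs → y ∈ˡ xs → c x ≡ c y → x ≡ y) →
  length ks < length xs → ∃ λ x → x ∈ˡ xs × c x ∉ˡ ks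
available c xs ks xs! injective ks<xs with any? (λ i → ¬? (c (lookup xs i) ∈ℕ? ks))
... | yes (i , ∉ks) = lookup xs i , ∈-lookup i , ∉ks
... | no none =
  let i , j , i<j , eq = pigeonhole ks<xs (index ∘ forbidden)
  in contradiction
       (injective (∈-lookup i) (∈-lookup j)
         (trans (lookup-index (forbidden i))
           (trans (cong (lookup ks) eq) (sym (lookup-index (forbidden j))))))
       (unique-lookup-< xs! i<j)
  where
  forbidden : ∀ i → c (lookup xs i) ∈ˡ ks
  forbidden i = decidable-stable (_ ∈ℕ? ks) λ ∉ks → none (i , ∉ks)

module _ (H : Graph (Fin n)) where
  open Graph H renaming (sym to adj-sym)
  open Replication H

  -- Embed the vertices of H in the order given by rank: a vertex u is sent to a
  -- candidate whose colour differs from those of the images of its rivals. Earlier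
  -- vertices that are not rivals get a different colour from properness.

  module Greedy
    (label : Fin m → Fin n)
    (rank : Fin n → Fin k) (rank-injective : ∀ {u w} → rank u ≡ rank w → u ≡ w)
    (candidates : Fin n → List (Fin m)) (rivals : Fin n → List (Fin n))
    (candidates-unique : ∀ u → Unique (candidates u))
    (candidates-label : ∀ u {x} → x ∈ˡ candidates u → label x ≈ u)
    (candidates-suffice : ∀ u → length (rivals u) < length (candidates u))
    (earlier-adjacent : ∀ u w → rank w <ᶠ rank u → w ∉ˡ rivals u → Adj u w × ¬ u ≈ w)
    where

    G : Graph (Fin m)
    G = blowup label

    module _ (c : Fin m → ℕ) (proper : Proper G c) where

      -- Candidates for one vertex have equivalent labels, so they form a clique of `G`.
      candidates-injective : ∀ u {x y} → x ∈ˡ candidates u → y ∈ˡ candidates u → c x ≡ c y → x ≡ y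
      candidates-injective u {x} {y} x∈ y∈ eq = decidable-stable (x ≟ y) λ x≢y →
        proper x y
          (x≢y , inj₁ (≈-trans (candidates-label u x∈) (≈-sym (candidates-label u y∈)))) eq

      choose : ∀ u (ks : List ℕ) → length ks < length (candidates u) →
        ∃ λ x → x ∈ˡ candidates u × c x ∉ˡ ks
      choose u ks = available c (candidates u) ks (candidates-unique u) (candidates-injective u)

      RainbowBelow : ℕ → (Fin n → Fin m) → Set
      RainbowBelow t f = ∀ u w → toℕ (rank u) < t → toℕ (rank w) < t → u ≢ w → c (f u) ≢ c (f w)

      Labelled : (Fin n → Fin m) → Set
      Labelled f = ∀ u → label (f u) ≈ u

      -- Induction on the number of ranks treated. The map is total throughout: vertices of rank at
      -- least `t` have provisional images, correctly labelled but with no condition on their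
      -- colours.
      embed : ∀ t → ∃ λ f → Labelled f × RainbowBelow t f
      embed zero =
        (λ u → proj₁ (start u)) , (λ u → candidates-label u (proj₁ (proj₂ (start u)))) , λ _ _ ()
        where
        start : ∀ u → ∃ λ x → x ∈ˡ candidates u × c x ∉ˡ []
        start u = choose u [] (ℕₚ.≤-<-trans z≤n (candidates-suffice u))
      embed (suc t) with embed t | any? (λ u → toℕ (rank u) ℕ.≟ t)
      -- `rank` need not be surjective; an unoccupied rank changes nothing.
      ... | f , labelled , rainbow | no ∄u =
        f , labelled , λ u w u<1+t w<1+t → rainbow u w (below u u<1+t) (below w w<1+t)
        where
        below : ∀ u → toℕ (rank u) < suc t → toℕ (rank u) < t
        below u u<1+t = [ id , (λ eq → contradiction (u , eq) ∄u) ]′ (m<1+n⇒m<n∨m≡n u<1+t)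
      ... | f , labelled , rainbow | yes (u₀ , refl) = f′ , labelled′ , rainbow′
        where
        choice : ∃ λ x → x ∈ˡ candidates u₀ × c x ∉ˡ map (c ∘ f) (rivals u₀)
        choice = choose u₀ _
          (ℕₚ.≤-<-trans (≤-reflexive (length-map (c ∘ f) (rivals u₀))) (candidates-suffice u₀))
        x₀ : Fin m
        x₀ = proj₁ choice
        x₀-label : label x₀ ≈ u₀
        x₀-label = candidates-label u₀ (proj₁ (proj₂ choice))

        -- A rival's colour was forbidden to `x₀`, so a shared colour means that `w` is not a rival.
        -- Then `u₀` and `w` are adjacent and in different classes, which makes `x₀` and `f w`
        -- adjacent in `G`, against properness.
        fresh : ∀ w → toℕ (rank w) < toℕ (rank u₀) → c x₀ ≢ c (f w)
        fresh w w<u₀ eq = proper x₀ (f w)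
          -- A common image would have a label equivalent to both `u₀` and `w`.
          ( (λ x₀≡fw → u₀≉w
              (≈-trans (≈-sym x₀-label) (subst (λ x → label x ≈ w) (sym x₀≡fw) (labelled w))))
          , inj₂ (adj-transport₂ (≈-sym x₀-label) (≈-sym (labelled w)) u₀≉w u₀w)) eq
          where
          u₀w×u₀≉w : Adj u₀ w × ¬ u₀ ≈ w
          u₀w×u₀≉w = earlier-adjacent u₀ w w<u₀ λ w∈ → proj₂ (proj₂ choice)
            (subst (_∈ˡ map (c ∘ f) (rivals u₀)) (sym eq) (∈-map⁺ (c ∘ f) w∈))
          u₀w = proj₁ u₀w×u₀≉w
          u₀≉w = proj₂ u₀w×u₀≉w

        f′ : Fin n → Fin m
        f′ w with w ≟ u₀
        ... | yes _ = x₀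
        ... | no  _ = f w

        labelled′ : Labelled f′
        labelled′ w with w ≟ u₀
        ... | yes refl = x₀-label
        ... | no  _    = labelled w

        below : ∀ w → w ≢ u₀ → toℕ (rank w) < suc (toℕ (rank u₀)) → toℕ (rank w) < toℕ (rank u₀)
        below w w≢u₀ w<1+t = [ id , (λ eq → contradiction (rank-injective (toℕ-injective eq)) w≢u₀) ]′
          (m<1+n⇒m<n∨m≡n w<1+t)

        rainbow′ : RainbowBelow (suc (toℕ (rank u₀))) f′
        rainbow′ u w u< w< u≢w with u ≟ u₀ | w ≟ u₀
        ... | yes refl | yes refl = contradiction refl u≢w
        ... | yes _    | no w≢u₀  = fresh w (below w w≢u₀ w<)
        ... | no u≢u₀  | yes _    = fresh u (below u u≢u₀ u<) ∘ sym
        ... | no u≢u₀  | no w≢u₀  = rainbow u w (below u u≢u₀ u<) (below w w≢u₀ w<) u≢w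

    -- All ranks lie below `k`, so after `k` rounds the whole image is rainbow. Each image lies in
    -- the blown-up class of its vertex, and classes decide adjacency.
    forces : ForcesRainbow G H
    forces c proper with embed c proper k
    ... | f , labelled , rainbow = embedding⇒subset G H (f , preserves , injective)
      where
      injective : ∀ x y → c (f x) ≡ c (f y) → x ≡ y
      injective x y eq = decidable-stable (x ≟ y) λ x≢y →
        rainbow x y (toℕ<n (rank x)) (toℕ<n (rank y)) x≢y eq

      preserves : ∀ x y → Adj x y ⇔ Graph.Adj G (f x) (f y)
      preserves x y = mk⇔ fwd bwd
        where
        fwd : Adj x y → Graph.Adj G (f x) (f y)
        fwd xy = (λ fx≡fy → irrefl (injective x y (cong c fx≡fy)) xy) , related
          where
          related : label (f x) ≈ label (f y) ⊎ Adj (label (f x)) (label (f y))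
          related with x ≈? y
          ... | yes x≈y = inj₁ (≈-trans (labelled x) (≈-trans x≈y (≈-sym (labelled y))))
          ... | no x≉y  =
            inj₂ (adj-transport₂ (≈-sym (labelled x)) (≈-sym (labelled y)) x≉y xy)

        bwd : Graph.Adj G (f x) (f y) → Adj x y
        bwd (fx≢fy , related) with x ≈? y | related
        -- Distinct images come from distinct vertices, here two members of one clique.
        ... | yes x≈y | _ = ≈-adj x≈y (fx≢fy ∘ cong f)
        ... | no x≉y | inj₁ ℓx≈ℓy =
          contradiction (≈-trans (≈-sym (labelled x)) (≈-trans ℓx≈ℓy (labelled y))) x≉y
        ... | no x≉y | inj₂ ℓxℓy = adj-transport₂ (labelled x) (labelled y)
          (λ ℓx≈ℓy → x≉y (≈-trans (≈-sym (labelled x)) (≈-trans ℓx≈ℓy (labelled y)))) ℓxℓy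

-- With n + 1 candidates for every vertex, all vertices may be rivals.

forcedOn-square : (H : Graph (Fin n)) → ForcedOn H (n * suc n)
forcedOn-square {n} H = G , forces
  where
  open Replication H

  candidates : Fin n → List (Fin (n * suc n))
  candidates u = map (combine u) (allFin (suc n))

  unique : ∀ u → Unique (candidates u)
  unique u = Unique.map⁺ (combine-injectiveʳ u _ u _) (Unique.allFin⁺ (suc n))

  labelled : ∀ u {x} → x ∈ˡ candidates u → quotient (suc n) x ≈ u
  labelled u x∈ with ∈-map⁻ (combine u) x∈
  ... | i , _ , refl = inj₁ (cong proj₁ (remQuot-combine u i))

  suffice : ∀ u → length (allFin n) < length (candidates u)
  suffice u = subst₂ _<_ (sym (length-tabulate id))
    (sym (trans (length-map (combine u) (allFin (suc n))) (length-tabulate id))) (ℕₚ.n<1+n n)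

  open Greedy H (quotient (suc n)) id id candidates (λ _ → allFin n) unique labelled suffice
    (λ _ w _ w∉ → contradiction (∈-allFin w) w∉)

-- Finite index sets as disjoint unions of blocks.

owner : (f : Fin k → ℕ) → Fin (total f) → Fin k
owner {suc k} f x = [ (λ _ → zero) , suc ∘ owner (f ∘ suc) ]′ (splitAt (f zero) x)

slot : (f : Fin k → ℕ) (i : Fin k) → Fin (f i) → Fin (total f)
slot f zero    j = j ↑ˡ _
slot f (suc i) j = f zero ↑ʳ slot (f ∘ suc) i j

owner-slot : ∀ (f : Fin k → ℕ) i j → owner f (slot f i j) ≡ i
owner-slot f zero    j rewrite splitAt-↑ˡ (f zero) j (total (f ∘ suc)) = refl
owner-slot f (suc i) j rewrite splitAt-↑ʳ (f zero) (total (f ∘ suc)) (slot (f ∘ suc) i j) =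
  cong suc (owner-slot (f ∘ suc) i j)

slot-injective : ∀ (f : Fin k → ℕ) i {j j′} → slot f i j ≡ slot f i j′ → j ≡ j′
slot-injective f zero    eq = ↑ˡ-injective _ _ _ eq
slot-injective f (suc i) eq = slot-injective (f ∘ suc) i (↑ʳ-injective (f zero) _ _ eq)

∈-⋃ : ∀ (Ks : List (Subset n)) {x} → x ∈ ⋃ Ks ⇔ (∃ λ K → K ∈ˡ Ks × x ∈ K)
∈-⋃ Ks = mk⇔ (fwd Ks) λ (K , K∈ , x∈) → bwd K∈ x∈
  where
  fwd : ∀ Ks {x} → x ∈ ⋃ Ks → ∃ λ K → K ∈ˡ Ks × x ∈ K
  fwd []       x∈ = contradiction x∈ ∉⊥
  fwd (K ∷ Ks) x∈ with x∈p∪q⁻ K (⋃ Ks) x∈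
  ... | inj₁ x∈K = K , here refl , x∈K
  ... | inj₂ x∈⋃ = let K′ , K′∈ , x∈K′ = fwd Ks x∈⋃ in K′ , there K′∈ , x∈K′
  bwd : ∀ {K Ks x} → K ∈ˡ Ks → x ∈ K → x ∈ ⋃ Ks
  bwd (here refl) x∈ = x∈p∪q⁺ (inj₁ x∈)
  bwd (there K∈)  x∈ = x∈p∪q⁺ (inj₂ (bwd K∈ x∈))

-- The blow-up given by an ordering of the cliques.

module Cliques (H : Graph (Fin n)) (O : CliqueOrdering H) where
  open Graph H renaming (sym to adj-sym)
  open Replication H
  open CliqueOrdering O

  private
    ∈-class : ∀ x y → y ∈ comprehension (x ≈?_) ⇔ x ≈ y
    ∈-class x = ∈-comprehension (x ≈?_)

  abstract
    clique-of : ∀ x → ∃ λ i → x ∈ KH i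
    clique-of x with exhaustive _ (x , ∈-class x)
    ... | i , KHi≡ = i , subst (x ∈_) (sym KHi≡) (from (∈-class x x) ≈-refl)

  cl : Fin n → Fin s
  cl x = proj₁ (clique-of x)

  ∈-cl : ∀ x → x ∈ KH (cl x)
  ∈-cl x = proj₂ (clique-of x)

  ∈-KH⇒≈ : ∀ {i x y} → x ∈ KH i → y ∈ KH i → x ≈ y
  ∈-KH⇒≈ {i} x∈ y∈ with isClique i
  ... | _ , K = ≈-trans (≈-sym (to (K _) x∈)) (to (K _) y∈)

  ≈-∈-KH : ∀ {i x y} → x ≈ y → x ∈ KH i → y ∈ KH i
  ≈-∈-KH {i} x≈y x∈ with isClique i
  ... | _ , K = from (K _) (≈-trans (to (K _) x∈) x≈y)

  -- Listed cliques sharing `x` are both its class, hence equal as subsets, and the listing has no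
  -- repetition.
  ∈-KH-unique : ∀ {i j x} → x ∈ KH i → x ∈ KH j → i ≡ j
  ∈-KH-unique xi xj = distinct (⊆-antisym
    (λ yi → ≈-∈-KH (∈-KH⇒≈ xi yi) xj)
    (λ yj → ≈-∈-KH (∈-KH⇒≈ xj yj) xi))

  ∈-KH⇒≡ : ∀ {i x} → x ∈ KH i → i ≡ cl x
  ∈-KH⇒≡ x∈ = ∈-KH-unique x∈ (∈-cl _)

  ∈-earlier : ∀ i x → x ∈ earlier i ⇔ cl x <ᶠ i
  ∈-earlier i x = mk⇔ fwd bwd
    where
    fwd : x ∈ earlier i → cl x <ᶠ i
    fwd x∈ with to (∈-⋃ _) x∈
    ... | _ , K∈ , x∈K with ∈-map⁻ KH K∈
    ... | j , j∈ , refl =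
      subst (_<ᶠ i) (∈-KH⇒≡ x∈K) (proj₂ (∈-filter⁻ (_<ᶠ? i) {xs = allFin s} j∈))
    bwd : cl x <ᶠ i → x ∈ earlier i
    bwd x<i = from (∈-⋃ _)
      (_ , ∈-map⁺ KH (∈-filter⁺ (_<ᶠ? i) (∈-allFin (cl x)) x<i) , ∈-cl x)

  module _ (v : Representatives H O) where

    rep : Fin s → Fin n
    rep i = proj₁ (v i)

    rep-cl : ∀ x → rep (cl x) ≈ x
    rep-cl x = ∈-KH⇒≈ (proj₂ (v (cl x))) (∈-cl x)

    -- The vertices of `G` are the `n` originals, each labelled by itself, and for each clique
    -- `spare i` further vertices labelled by its representative.
    forcedOn-bound : ForcedOn H (bound H O v)
    forcedOn-bound = G , forces
      where
      spare : Fin s → ℕ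
      spare i = nonEdges H (rep i) (earlier i)

      label : Fin (n + total spare) → Fin n
      label x = [ id , rep ∘ owner spare ]′ (splitAt n x)

      label-↑ˡ : ∀ u → label (u ↑ˡ total spare) ≡ u
      label-↑ˡ u rewrite splitAt-↑ˡ n u (total spare) = refl

      label-slot : ∀ i j → label (n ↑ʳ slot spare i j) ≡ rep i
      label-slot i j rewrite splitAt-↑ʳ n (total spare) (slot spare i j) =
        cong rep (owner-slot spare i j)

      ↑ˡ≢↑ʳ : ∀ {i j} → i ↑ˡ total spare ≢ n ↑ʳ j
      ↑ˡ≢↑ʳ {i} {j} eq with trans (sym (splitAt-↑ˡ n i (total spare)))
                              (trans (cong (splitAt n) eq) (splitAt-↑ʳ n (total spare) j))
      ... | ()

      peer? : ∀ u w → Dec (u ≢ w × u ≈ w)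
      peer? u w = ¬? (u ≟ w) ×-dec (u ≈? w)

      peers : Fin n → List (Fin n)
      peers u = filter (peer? u) (allFin n)

      originals spares candidates : Fin n → List (Fin (n + total spare))
      originals u  = map (_↑ˡ total spare) (u ∷ peers u)
      spares u     = map (λ j → n ↑ʳ slot spare (cl u) j) (allFin (spare (cl u)))
      candidates u = originals u ++ spares u

      nonEdge? : ∀ i w → Dec (w ∈ earlier i × rep i ≢ w × ¬ Adj (rep i) w)
      nonEdge? i w = (w ∈? earlier i) ×-dec ¬? (rep i ≟ w) ×-dec ¬? (rep i adj? w)

      rivals : Fin n → List (Fin n)
      rivals u = peers u ++ filter (nonEdge? (cl u)) (allFin n)

      unique : ∀ u → Unique (candidates u)
      unique u = Unique.++⁺
        (Unique.map⁺ (↑ˡ-injective _ _ _)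
          (All.tabulate (λ w∈ → proj₁ (proj₂ (∈-filter⁻ (peer? u) {xs = allFin n} w∈)))
           ∷ Unique.filter⁺ (peer? u) (Unique.allFin⁺ n)))
        (Unique.map⁺ (slot-injective spare (cl u) ∘ ↑ʳ-injective n _ _) (Unique.allFin⁺ _))
        λ (x∈o , x∈s) →
          let _ , _ , x≡i = ∈-map⁻ _ x∈o
              _ , _ , x≡j = ∈-map⁻ _ x∈s
          in ↑ˡ≢↑ʳ (trans (sym x≡i) x≡j)

      labelled : ∀ u {x} → x ∈ˡ candidates u → label x ≈ u
      labelled u x∈ with ∈-++⁻ (originals u) x∈
      labelled u x∈ | inj₁ x∈o with ∈-map⁻ _ x∈o
      ... | w , here refl , refl = inj₁ (label-↑ˡ w)
      ... | w , there w∈ , refl =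
        ≈-trans (inj₁ (label-↑ˡ w))
          (≈-sym (proj₂ (proj₂ (∈-filter⁻ (peer? u) {xs = allFin n} w∈))))
      labelled u x∈ | inj₂ x∈s with ∈-map⁻ _ x∈s
      ... | j , _ , refl = ≈-trans (inj₁ (label-slot (cl u) j)) (rep-cl u)

      -- Peers match the originals of peers, and non-edges match the spares; the one candidate in
      -- excess is the original of `u` itself.
      suffice : ∀ u → length (rivals u) < length (candidates u)
      suffice u = ≤-reflexive (begin
        suc (length (peers u ++ filter (nonEdge? (cl u)) (allFin n)))
          ≡⟨ cong suc (length-++ (peers u)) ⟩
        suc (length (peers u)) + spare (cl u)
          ≡⟨ cong₂ _+_ (length-map (_↑ˡ total spare) (u ∷ peers u))
               (trans (length-map _ (allFin (spare (cl u)))) (length-tabulate id)) ⟨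
        length (originals u) + length (spares u)
          ≡⟨ length-++ (originals u) ⟨
        length (candidates u) ∎)
        where open ≡-Reasoning

      -- `combine` orders lexicographically: by clique in the given order, then by vertex, which
      -- makes `rank` injective.
      rank : Fin n → Fin (s * n)
      rank u = combine (cl u) u

      -- Not being a peer, `w` lies in another clique, which must come earlier. Not being a counted
      -- non-neighbour, it is adjacent to the representative, hence to `u`.
      earlier-adjacent : ∀ u w → rank w <ᶠ rank u → w ∉ˡ rivals u → Adj u w × ¬ u ≈ w
      earlier-adjacent u w w<u w∉ = uw , u≉w
        where
        u≉w : ¬ u ≈ w
        u≉w u≈w = w∉ (∈-++⁺ˡ (∈-filter⁺ (peer? u) (∈-allFin w)
          ((λ u≡w → <⇒≢ w<u (cong rank (sym u≡w))) , u≈w)))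
        clw<clu : cl w <ᶠ cl u
        clw<clu with <-cmp (cl w) (cl u)
        ... | tri< lt _ _ = lt
        ... | tri≈ _ eq _ = contradiction
          (≈-trans (≈-sym (rep-cl u)) (subst (λ i → rep i ≈ w) eq (rep-cl w))) u≉w
        -- A later clique would give `w` the larger rank, whatever the vertices are.
        ... | tri> _ _ gt = contradiction (combine-monoˡ-< u w gt) (ℕₚ.<-asym w<u)
        uw : Adj u w
        uw with rep (cl u) adj? w
        ... | yes rw = adj-transport (rep-cl u) u≉w rw
        ... | no ¬rw = contradiction
          (∈-++⁺ʳ (peers u) (∈-filter⁺ (nonEdge? (cl u)) (∈-allFin w)
            (from (∈-earlier (cl u) w) clw<clu , r≢w , ¬rw))) w∉
          where
          r≢w : rep (cl u) ≢ w
          r≢w refl = u≉w (≈-sym (rep-cl u))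

      open Greedy H label rank (λ {u} {w} → combine-injectiveʳ (cl u) u (cl w) w)
        candidates rivals unique labelled suffice earlier-adjacent

-- Counting by sums of indicators.

indicator : Dec A → ℕ
indicator a? = if does a? then 1 else 0

indicator-⇔ : A ⇔ B → (a? : Dec A) (b? : Dec B) → indicator a? ≡ indicator b?
indicator-⇔ A⇔B a? b? = cong (if_then 1 else 0) (does-⇔ A⇔B a? b?)

indicator-yes : (a? : Dec A) → A → indicator a? ≡ 1
indicator-yes a? a = cong (if_then 1 else 0) (dec-true a? a)

indicator-no : (a? : Dec A) → ¬ A → indicator a? ≡ 0
indicator-no a? ¬a = cong (if_then 1 else 0) (dec-false a? ¬a)

length-filter-tabulate : {P : Pred A p} (P? : Decidable P) (f : Fin k → A) →
  length (filter P? (tabulate f)) ≡ total (indicator ∘ P? ∘ f)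
length-filter-tabulate {k = zero}  P? f = refl
length-filter-tabulate {k = suc k} P? f with does (P? (f zero))
... | true  = cong suc (length-filter-tabulate P? (f ∘ suc))
... | false = length-filter-tabulate P? (f ∘ suc)

∣∣-total : (S : Subset n) → ∣ S ∣ ≡ total (λ x → indicator (x ∈? S))
∣∣-total []            = refl
∣∣-total (inside  ∷ S) = cong suc (∣∣-total S)
∣∣-total (outside ∷ S) = ∣∣-total S

total-mono : {f g : Fin k → ℕ} → (∀ i → f i ≤ g i) → total f ≤ total g
total-mono {zero}  f≤g = z≤n
total-mono {suc k} f≤g = ℕₚ.+-mono-≤ (f≤g zero) (total-mono (f≤g ∘ suc))

total-zero : (f : Fin k → ℕ) → (∀ i → f i ≡ 0) → total f ≡ 0
total-zero {zero}  f f≡0 = refl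
total-zero {suc k} f f≡0 = cong₂ _+_ (f≡0 zero) (total-zero (f ∘ suc) (f≡0 ∘ suc))

total-single : (j : Fin k) (g : Fin k → ℕ) → (∀ i → i ≢ j → g i ≡ 0) → total g ≡ g j
total-single zero    g g≡0 =
  trans (cong (g zero +_) (total-zero (g ∘ suc) λ i → g≡0 (suc i) λ ())) (ℕₚ.+-identityʳ _)
total-single (suc j) g g≡0 = cong₂ _+_ (g≡0 zero λ ())
  (total-single j (g ∘ suc) λ i i≢j → g≡0 (suc i) (i≢j ∘ suc-injective))

-- The bound as a sum over pairs of cliques.

module PairCount (H : Graph (Fin n)) (O : CliqueOrdering H) (v : Representatives H O) where
  open Graph H renaming (sym to adj-sym)
  open Replication H
  open CliqueOrdering O
  open Cliques H O

  r : Fin s → Fin n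
  r = rep v

  EarlierNonadjacent : Fin s → Fin s → Set
  EarlierNonadjacent i j = j <ᶠ i × ¬ Adj (r i) (r j)

  earlierNonadjacent? : ∀ i j → Dec (EarlierNonadjacent i j)
  earlierNonadjacent? i j = (j <ᶠ? i) ×-dec ¬? (r i adj? r j)

  -- The contribution of `KH j` to n_i: all of its vertices count or none does.
  cost : Fin s → Fin s → ℕ
  cost i j = indicator (earlierNonadjacent? i j) * ∣ KH j ∣

  cost-yes : ∀ {i j} → EarlierNonadjacent i j → cost i j ≡ ∣ KH j ∣
  cost-yes {i} {j} p = trans (cong (_* ∣ KH j ∣) (indicator-yes (earlierNonadjacent? i j) p))
    (ℕₚ.*-identityˡ _)

  cost-no : ∀ {i j} → ¬ EarlierNonadjacent i j → cost i j ≡ 0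
  cost-no {i} {j} ¬p = cong (_* ∣ KH j ∣) (indicator-no (earlierNonadjacent? i j) ¬p)

  r-≉ : ∀ {i j} → i ≢ j → ¬ r i ≈ r j
  r-≉ {i} {j} i≢j ri≈rj = i≢j (∈-KH-unique (≈-∈-KH ri≈rj (proj₂ (v i))) (proj₂ (v j)))

  -- Adjacency between different cliques does not depend on the chosen vertices, so `u` may be
  -- replaced by the representative of its clique.
  nonEdge-class : ∀ i u →
    (u ∈ earlier i × r i ≢ u × ¬ Adj (r i) u) ⇔ EarlierNonadjacent i (cl u)
  nonEdge-class i u = mk⇔ fwd bwd
    where
    i≉u : cl u <ᶠ i → ¬ r i ≈ u
    i≉u u<i ri≈u = r-≉ (<⇒≢ u<i ∘ sym) (≈-trans ri≈u (≈-sym (rep-cl v u)))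
    fwd : _ → _
    fwd (u∈ , _ , ¬riu) = u<i , λ rir →
      ¬riu (adj-transport₂ ≈-refl (rep-cl v u) (r-≉ (<⇒≢ u<i ∘ sym)) rir)
      where u<i = to (∈-earlier i u) u∈
    bwd : _ → _
    bwd (u<i , ¬rir) = from (∈-earlier i u) u<i , (λ ri≡u → i≉u u<i (inj₁ ri≡u)) , λ riu →
      ¬rir (adj-transport₂ ≈-refl (≈-sym (rep-cl v u)) (i≉u u<i) riu)

  -- Double counting: the counted vertices are split by clique and the sums exchanged.
  nonEdges-cost : ∀ i → nonEdges H (r i) (earlier i) ≡ total (cost i)
  nonEdges-cost i = begin
    nonEdges H (r i) (earlier i)
      ≡⟨ length-filter-tabulate nonEdge? id ⟩
    total (λ u → indicator (nonEdge? u))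
      ≡⟨ sum-cong-≗ splitByClique ⟩
    total (λ u → total λ j → w j * indicator (u ∈? KH j))
      ≡⟨ ∑-comm (λ u j → w j * indicator (u ∈? KH j)) ⟩
    total (λ j → total λ u → w j * indicator (u ∈? KH j))
      ≡⟨ sum-cong-≗ (λ j → trans (sym (*-distribˡ-sum (w j) (λ u → indicator (u ∈? KH j))))
           (cong (w j *_) (sym (∣∣-total (KH j))))) ⟩
    total (cost i) ∎
    where
    open ≡-Reasoning
    w : Fin s → ℕ
    w j = indicator (earlierNonadjacent? i j)
    nonEdge? : ∀ u → Dec (u ∈ earlier i × r i ≢ u × ¬ Adj (r i) u)
    nonEdge? u = (u ∈? earlier i) ×-dec ¬? (r i ≟ u) ×-dec ¬? (r i adj? u)
    splitByClique : ∀ u → indicator (nonEdge? u) ≡ total λ j → w j * indicator (u ∈? KH j)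
    splitByClique u = begin
      indicator (nonEdge? u)
        ≡⟨ indicator-⇔ (nonEdge-class i u) (nonEdge? u) (earlierNonadjacent? i (cl u)) ⟩
      w (cl u)
        ≡⟨ ℕₚ.*-identityʳ _ ⟨
      w (cl u) * 1
        ≡⟨ cong (w (cl u) *_) (indicator-yes (u ∈? KH (cl u)) (∈-cl u)) ⟨
      w (cl u) * indicator (u ∈? KH (cl u))
        -- No other clique contains `u`, so all other terms vanish.
        ≡⟨ total-single (cl u) _ (λ j j≢ →
             trans (cong (w j *_) (indicator-no (u ∈? KH j) (j≢ ∘ ∈-KH⇒≡))) (ℕₚ.*-zeroʳ (w j))) ⟨
      total (λ j → w j * indicator (u ∈? KH j)) ∎

  totalCost : ℕ
  totalCost = total λ i → total (cost i)

  bound-cost : bound H O v ≡ n + totalCost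
  bound-cost = cong (n +_) (sum-cong-≗ nonEdges-cost)

  -- Summing both orders of each pair makes the summand symmetric, so that it can
  -- be compared across orderings pair by pair.

  pairCost : Fin s → Fin s → ℕ
  pairCost i j = cost i j + cost j i

  pairCost-comm : ∀ i j → pairCost i j ≡ pairCost j i
  pairCost-comm i j = ℕₚ.+-comm (cost i j) (cost j i)

  -- The second copy of the double sum is read with its indices exchanged.
  totalCost-double : totalCost + totalCost ≡ total λ i → total (pairCost i)
  totalCost-double = begin
    totalCost + totalCost
      ≡⟨ cong (totalCost +_) (∑-comm cost) ⟩
    totalCost + total (λ i → total λ j → cost j i)
      ≡⟨ ∑-distrib-+ (λ i → total (cost i)) (λ i → total λ j → cost j i) ⟨
    total (λ i → total (cost i) + total λ j → cost j i)
      ≡⟨ sum-cong-≗ (λ i → ∑-distrib-+ (cost i) (λ j → cost j i)) ⟨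
    total (λ i → total (pairCost i)) ∎
    where open ≡-Reasoning

  pairCost-later : ∀ {i j} → j <ᶠ i → ¬ Adj (r i) (r j) → pairCost i j ≡ ∣ KH j ∣
  pairCost-later {i} {j} j<i ¬ij =
    trans (cong₂ _+_ (cost-yes (j<i , ¬ij)) (cost-no λ (i<j , _) → ℕₚ.<-asym j<i i<j))
      (ℕₚ.+-identityʳ _)

  pairCost-≡0 : ∀ {i j} → i ≡ j → pairCost i j ≡ 0
  pairCost-≡0 {i} refl = cong₂ _+_ irr irr
    where irr = cost-no {i} {i} λ (i<i , _) → ℕₚ.<-irrefl refl i<i

  pairCost-adj : ∀ {i j} → Adj (r i) (r j) → pairCost i j ≡ 0
  pairCost-adj ij = cong₂ _+_ (cost-no λ (_ , ¬ij) → ¬ij ij) (cost-no λ (_ , ¬ji) → ¬ji (adj-sym ij))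

-- Comparison of a sorted ordering with another one.

module Reorder (H : Graph (Fin n)) (O O′ : CliqueOrdering H)
               (v : Representatives H O) (v′ : Representatives H O′) where
  open Graph H renaming (sym to adj-sym)
  open Replication H
  private
    module O  = CliqueOrdering O
    module O′ = CliqueOrdering O′
    module P  = PairCount H O v
    module P′ = PairCount H O′ v′

  -- Matches positions holding the same clique. Both orderings list every clique exactly once, so
  -- this is a bijection.
  σ : Fin O.s → Fin O′.s
  σ i = proj₁ (O′.exhaustive (O.KH i) (O.isClique i))

  σ-KH : ∀ i → O′.KH (σ i) ≡ O.KH i
  σ-KH i = proj₂ (O′.exhaustive (O.KH i) (O.isClique i))

  private
    σ⁻¹ : Fin O′.s → Fin O.s
    σ⁻¹ i = proj₁ (O.exhaustive (O′.KH i) (O′.isClique i))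

    σ⁻¹-KH : ∀ i → O.KH (σ⁻¹ i) ≡ O′.KH i
    σ⁻¹-KH i = proj₂ (O.exhaustive (O′.KH i) (O′.isClique i))

  π : Permutation O.s O′.s
  π = permutation σ σ⁻¹
    (λ i → O′.distinct (trans (σ-KH (σ⁻¹ i)) (σ⁻¹-KH i)))
    (λ i → O.distinct (trans (σ⁻¹-KH (σ i)) (σ-KH i)))

  rep-≈ : ∀ i → P.r i ≈ P′.r (σ i)
  rep-≈ i = Cliques.∈-KH⇒≈ H O (proj₂ (v i)) (subst (P′.r (σ i) ∈_) (σ-KH i) (proj₂ (v′ (σ i))))

  nonadjacent : ∀ {i j} → i ≢ j → ¬ Adj (P.r i) (P.r j) → ¬ Adj (P′.r (σ i)) (P′.r (σ j))
  nonadjacent {i} {j} i≢j ¬ij ij′ = ¬ij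
    (adj-transport₂ (≈-sym (rep-≈ i)) (≈-sym (rep-≈ j)) σi≉σj ij′)
    where
    σi≉σj : ¬ P′.r (σ i) ≈ P′.r (σ j)
    σi≉σj eq = P.r-≉ i≢j (≈-trans (rep-≈ i) (≈-trans eq (≈-sym (rep-≈ j))))

  module _ (sorted : Sorted H O) where

    -- A nonadjacent pair is charged the size of its earlier member. The sorted ordering charges
    -- `KH j`, the smaller size, while `O′` charges one of the two; adjacent pairs cost nothing.
    pairCost-later-≤ : ∀ {i j} → j <ᶠ i → P.pairCost i j ≤ P′.pairCost (σ i) (σ j)
    pairCost-later-≤ {i} {j} j<i = byAdjacency (P.r i adj? P.r j)
      where
      i≢j : i ≢ j
      i≢j = <⇒≢ j<i ∘ sym
      σi≢σj : σ i ≢ σ j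
      σi≢σj eq = i≢j (O.distinct (trans (sym (σ-KH i)) (trans (cong O′.KH eq) (σ-KH j))))
      lower : ¬ Adj (P′.r (σ i)) (P′.r (σ j)) → ∣ O.KH j ∣ ≤ P′.pairCost (σ i) (σ j)
      lower ¬ij′ with <-cmp (σ j) (σ i)
      ... | tri< lt _ _ = ≤-reflexive
        (sym (trans (P′.pairCost-later lt ¬ij′) (cong ∣_∣ (σ-KH j))))
      ... | tri≈ _ eq _ = contradiction (sym eq) σi≢σj
      -- `O′` reverses the pair and charges `KH i`; sortedness enters here.
      ... | tri> _ _ gt = ℕₚ.≤-trans (sorted j i (ℕₚ.<⇒≤ j<i)) (≤-reflexive (sym
        (trans (P′.pairCost-comm (σ i) (σ j))
          (trans (P′.pairCost-later gt (¬ij′ ∘ adj-sym)) (cong ∣_∣ (σ-KH i))))))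
      byAdjacency : Dec (Adj (P.r i) (P.r j)) → P.pairCost i j ≤ P′.pairCost (σ i) (σ j)
      byAdjacency (yes ij) = ℕₚ.≤-trans (≤-reflexive (P.pairCost-adj ij)) z≤n
      byAdjacency (no ¬ij) =
        ℕₚ.≤-trans (≤-reflexive (P.pairCost-later j<i ¬ij)) (lower (nonadjacent i≢j ¬ij))

    pairCost-≤ : ∀ i j → P.pairCost i j ≤ P′.pairCost (σ i) (σ j)
    pairCost-≤ i j with <-cmp j i
    ... | tri< lt _ _ = pairCost-later-≤ lt
    ... | tri≈ _ eq _ = ℕₚ.≤-trans (≤-reflexive (P.pairCost-≡0 (sym eq))) z≤n
    ... | tri> _ _ gt =
      subst₂ _≤_ (P.pairCost-comm j i) (P′.pairCost-comm (σ j) (σ i)) (pairCost-later-≤ gt)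

    -- The pairwise comparison is summed over positions of `O`; the right-hand side is then
    -- reindexed along `π`, in the inner and in the outer sum.
    totalCost-double-≤ : P.totalCost + P.totalCost ≤ P′.totalCost + P′.totalCost
    totalCost-double-≤ = begin
      P.totalCost + P.totalCost
        ≡⟨ P.totalCost-double ⟩
      total (λ i → total (P.pairCost i))
        ≤⟨ total-mono (λ i → total-mono (pairCost-≤ i)) ⟩
      total (λ i → total λ j → P′.pairCost (σ i) (σ j))
        ≡⟨ sum-cong-≗ (λ i → sum-permute (P′.pairCost (σ i)) π) ⟨
      total (λ i → total (P′.pairCost (σ i)))
        ≡⟨ sum-permute (λ i → total (P′.pairCost i)) π ⟨
      total (λ i → total (P′.pairCost i))
        ≡⟨ P′.totalCost-double ⟨
      P′.totalCost + P′.totalCost ∎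
      where open ℕₚ.≤-Reasoning

    bound-sorted-≤ : bound H O v ≤ bound H O′ v′
    bound-sorted-≤ = subst₂ _≤_ (sym P.bound-cost) (sym P′.bound-cost) (ℕₚ.+-monoʳ-≤ n
      -- Halving: a strict inequality the other way would survive doubling.
      (ℕₚ.≮⇒≥ λ lt → ℕₚ.<⇒≱ (ℕₚ.+-mono-< lt lt) totalCost-double-≤))

theorem3p1 : ∀ (n : ℕ) (H : Graph (Fin n)) →
    (Σ ℕ λ ρ → Is-ρ H ρ ×
    (∀ (O : CliqueOrdering H) (v : Representatives H O) → ρ ≤ bound H O v))
    × (∀ (O O′ : CliqueOrdering H) (v : Representatives H O) (v′ : Representatives H O′) →
    Sorted H O → bound H O v ≤ bound H O′ v′)
theorem3p1 n H = (ρ , (forced , minimal) , bounded) , Reorder.bound-sorted-≤ H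
  where
  -- ρ(H) is fixed before any ordering is given, so the search starts from a witness that needs
  -- none.
  minimum = least (forcedOn? H) (_ , forcedOn-square H)
  ρ = proj₁ minimum
  forced = proj₁ (proj₂ minimum)
  minimal = proj₂ (proj₂ minimum)
  bounded : ∀ (O : CliqueOrdering H) (v : Representatives H O) → ρ ≤ bound H O v
  bounded O v = minimal _ (Cliques.forcedOn-bound H O v)
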